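{- Let $n\geq 1$, let $\alpha,\beta,d\in\mathbb{Z}$ with $1\leq d\leq n$, and consider the complete graph $K_n$ with an initial configuration $c_0$ in which $d$ of the vertices receive $\alpha$ chips and the remaining $n-d$ vertices receive $\beta$ chips. Then this configuration is tight, i.e. there exists $t\geq 0$ with $c_{t+2}=c_t$.
   Context: Diffusion process: for a finite simple graph $G$ and a chip configuration $c_t:V(G)\to\mathbb{Z}$ (negative values allowed), the next configuration is defined simultaneously for every vertex $u$ by $c_{t+1}(u)=c_t(u)-|\{w\in N(u): c_t(u)>c_t(w)\}|+|\{w\in N(u): c_t(u)<c_t(w)\}|$. A graph with initial configuration is tight if the process is eventually fixed or eventually periodic with period length $2$, equivalently $c_{t+2}=c_t$ for some $t\geq0$. -}

module Defs where

open import Data.Fin using (Fin)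
import Data.Fin.Properties as Fin
open import Data.Fin.Subset using (Subset; _∈_; _∉_; ∣_∣)
open import Data.Integer using (ℤ; +_; _+_; _-_; _<_; _>_)
open import Data.Integer.Properties using (_<?_)
open import Data.Nat using (ℕ; zero; suc)
open import Data.Product using (∃; _×_)
open import Data.Vec using (count; allFin)
open import Level using (0ℓ)
open import Relation.Binary.Core using (Rel)
open import Relation.Binary.Definitions using (Decidable; Symmetric; Irreflexive)
open import Relation.Binary.PropositionalEquality using (_≡_; _≢_; _≗_; ≢-sym)
open import Relation.Nullary.Decidable using (_×-dec_; ¬?)
open import Relation.Unary using (Pred) renaming (Decidable to Decidable₁)

record SimpleGraph (n : ℕ) : Set₁ where
  field
    Adj    : Rel (Fin n) 0ℓ
    adj?   : Decidable Adj
    sym    : Symmetric Adj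
    irrefl : Irreflexive _≡_ Adj

open SimpleGraph

K : ∀ n → SimpleGraph n
K n .Adj u v        = u ≢ v
K n .adj? u v       = ¬? (u Fin.≟ v)
K n .sym            = ≢-sym
K n .irrefl u≡v u≢v = u≢v u≡v

Config : ℕ → Set
Config n = Fin n → ℤ

module _ {n : ℕ} where

  #_ : {P : Pred (Fin n) 0ℓ} → Decidable₁ P → ℕ
  # P? = count P? (allFin n)

  Poorer Richer : SimpleGraph n → Config n → Fin n → Pred (Fin n) 0ℓ
  Poorer G c u w = Adj G u w × c u > c w
  Richer G c u w = Adj G u w × c u < c w

  poorer? : ∀ G c u → Decidable₁ (Poorer G c u)
  poorer? G c u w = adj? G u w ×-dec (c w <? c u)

  richer? : ∀ G c u → Decidable₁ (Richer G c u)
  richer? G c u w = adj? G u w ×-dec (c u <? c w)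

  step : SimpleGraph n → Config n → Config n
  step G c u = c u - + (# poorer? G c u) + + (# richer? G c u)

  config : SimpleGraph n → Config n → ℕ → Config n
  config G c₀ zero    = c₀
  config G c₀ (suc t) = step G (config G c₀ t)

  Tight : SimpleGraph n → Config n → Set
  Tight G c₀ = ∃ λ t → config G c₀ (suc (suc t)) ≗ config G c₀ t

  -- d vertices hold α chips and the remaining ones hold β; the values α and β
  -- are allowed to coincide, so S is data rather than the preimage of α.
  TwoValued : ℤ → ℤ → ℤ → Config n → Set
  TwoValued d α β c = ∃ λ (S : Subset n) →
    + ∣ S ∣ ≡ d × (∀ v → v ∈ S → c v ≡ α) × (∀ v → v ∉ S → c v ≡ β)

{-# OPTIONS --safe #-}
module Submission where

-- On K n a configuration with value a on S and b off S keeps this shape: if a > b, one step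
-- gives a - |∁ S| on S and b + |S| off S, so the gap a - b drops by exactly n. Hence a
-- nonnegative gap decreases until it is 0, where the configuration is constant and fixed,
-- or lies strictly between 0 and n, where the next step reverses the sign of the gap and the
-- one after that undoes it.

open import Defs
open import Data.Integer using (ℤ; +_; 1ℤ; _≤_)
open import Data.Nat using (ℕ; _≥_)

open import Algebra.Lattice.Properties.BooleanAlgebra using (¬-involutive)
open import Data.Empty using (⊥-elim)
open import Data.Fin using (Fin; zero; suc)
open import Data.Fin.Subset using (Subset; inside; outside; _∈_; _∉_; ∣_∣; ∁; ⊥)
open import Data.Fin.Subset.Properties
  using (_∈?_; ∉⊥; ∣⊥∣≡0; ∣p∣≤n; ∣∁p∣≡n∸∣p∣; drop-there; x∈∁p⇒x∉p; x∉∁p⇒x∈p; x∉p⇒x∈∁p; ∪-∩-booleanAlgebra)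
open import Data.Integer using (0ℤ; +<+; _+_; _-_; _<_; _>_)
import Data.Integer as ℤ
import Data.Integer.Properties as ℤ
open import Data.Integer.Tactic.RingSolver using (solve-∀)
import Data.Nat as ℕ
open import Data.Nat.Induction using (Acc; acc; <-wellFounded)
import Data.Nat.Properties as ℕ
open import Data.Product using (_×_; _,_)
open import Data.Sum using (inj₁; inj₂)
open import Data.Vec using ([]; _∷_; here; there; count; tabulate)
open import Function using (_∘_; _⇔_; mk⇔; Equivalence)
open import Relation.Binary.PropositionalEquality
open import Relation.Nullary using (¬_; yes; no; contradiction)
open import Relation.Unary using (Pred; Decidable)

open Equivalence using (to; from)

-- Turns the counts in `step` into cardinalities of subsets, since `allFin n` is the tabulated
-- identity. A general `f` is needed for the induction, which passes from `f` to `f ∘ suc`.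
count-tabulate : ∀ {a p} {A : Set a} {P : Pred A p} (P? : Decidable P) →
  ∀ {n} (f : Fin n → A) (S : Subset n) →
  (∀ i → P (f i) ⇔ i ∈ S) → count P? (tabulate f) ≡ ∣ S ∣
count-tabulate P? f []      P⇔S = refl
count-tabulate P? f (s ∷ S) P⇔S with P? (f zero) | s | P⇔S zero
... | yes _ | inside  | _ = cong ℕ.suc (count-tabulate P? (f ∘ suc) S
      λ i → mk⇔ (drop-there ∘ to (P⇔S (suc i))) (from (P⇔S (suc i)) ∘ there))
... | no _  | outside | _ = count-tabulate P? (f ∘ suc) S
      λ i → mk⇔ (drop-there ∘ to (P⇔S (suc i))) (from (P⇔S (suc i)) ∘ there)
... | yes p | outside | e = contradiction (to e p) λ ()
... | no ¬p | inside  | e = contradiction (from e here) ¬p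

∣p∣+∣∁p∣≡n : ∀ {n} (p : Subset n) → ∣ p ∣ ℕ.+ ∣ ∁ p ∣ ≡ n
∣p∣+∣∁p∣≡n p = trans (cong (∣ p ∣ ℕ.+_) (∣∁p∣≡n∸∣p∣ p)) (ℕ.m+[n∸m]≡n (∣p∣≤n p))

∣∁∁p∣≡∣p∣ : ∀ {n} (p : Subset n) → ∣ ∁ (∁ p) ∣ ≡ ∣ p ∣
∣∁∁p∣≡∣p∣ {n} p = cong ∣_∣ (¬-involutive (∪-∩-booleanAlgebra n) p)

-- `config` adds each new step on the outside; this moves the extra step to the start of the
-- process.
config-step : ∀ {n} (G : SimpleGraph n) c t → config G (step G c) t ≡ config G c (ℕ.suc t)
config-step G c ℕ.zero    = refl
config-step G c (ℕ.suc t) = cong (step G) (config-step G c t)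

Tight-step⁻ : ∀ {n} (G : SimpleGraph n) c → Tight G (step G c) → Tight G c
Tight-step⁻ G c (t , eq) = ℕ.suc t , λ u →
  subst₂ (λ x y → x u ≡ y u) (config-step G c (2 ℕ.+ t)) (config-step G c t) (eq u)

module _ {n : ℕ} where

  -- The shape of `TwoValued` with the set as a parameter and its size dropped: along the process
  -- `S` stays fixed and only the two values move.
  Split : Subset n → ℤ → ℤ → Config n → Set
  Split S a b c = (∀ v → v ∈ S → c v ≡ a) × (∀ v → v ∉ S → c v ≡ b)

  Split-∁ : ∀ {S a b c} → Split S a b c → Split (∁ S) b a c
  Split-∁ (on , off) = (λ v → off v ∘ x∈∁p⇒x∉p) , (λ v → on v ∘ x∉∁p⇒x∈p)

  -- Argued on membership directly, because `Split-∁` would end at `∁ (∁ S)` rather than at `S`.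
  Split-∁⁻ : ∀ {S a b c} → Split (∁ S) b a c → Split S a b c
  Split-∁⁻ (on , off) = (λ v v∈S → off v (λ v∈∁S → x∈∁p⇒x∉p v∈∁S v∈S)) , (λ v → on v ∘ x∉p⇒x∈∁p)

  Split-unique : ∀ {S a b c c′} → Split S a b c → Split S a b c′ → c ≗ c′
  Split-unique {S} (on , off) (on′ , off′) v with v ∈? S
  ... | yes v∈S = trans (on v v∈S) (sym (on′ v v∈S))
  ... | no  v∉S = trans (off v v∉S) (sym (off′ v v∉S))

  step-value : ∀ {c : Config n} {u a} (P R : Subset n) → c u ≡ a →
    (∀ w → Poorer (K n) c u w ⇔ w ∈ P) → (∀ w → Richer (K n) c u w ⇔ w ∈ R) →
    step (K n) c u ≡ a - + ∣ P ∣ + + ∣ R ∣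
  step-value {c} {u} P R cu≡a poor rich = cong₂ _+_
    (cong₂ (λ x k → x - + k) cu≡a (count-tabulate (poorer? (K n) c u) _ P poor))
    (cong +_ (count-tabulate (richer? (K n) c u) _ R rich))

  empty : ∀ {p} {P : Pred (Fin n) p} → (∀ w → ¬ P w) → ∀ w → P w ⇔ w ∈ ⊥
  empty ¬P w = mk⇔ (⊥-elim ∘ ¬P w) (⊥-elim ∘ ∉⊥)

  -- Vertices on the same side hold equal values and exchange nothing, while every pair across the
  -- two sides is adjacent. So a vertex of `S` has exactly `∁ S` as poorer neighbours and no richer
  -- ones, and a vertex off `S` has exactly `S` as richer neighbours and no poorer ones.
  Split-step-> : ∀ {S a b c} → a > b → Split S a b c →
    Split S (a - + ∣ ∁ S ∣) (b + + ∣ S ∣) (step (K n) c)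
  Split-step-> {S} {a} {b} {c} b<a (on , off) = on-step , off-step
    where
    on-step : ∀ v → v ∈ S → step (K n) c v ≡ a - + ∣ ∁ S ∣
    on-step v v∈S = begin
      step (K n) c v                         ≡⟨ step-value {c} (∁ S) ⊥ cv≡a poor (empty rich) ⟩
      a - + ∣ ∁ S ∣ + + ∣ ⊥ {n} ∣             ≡⟨ cong (λ k → a - + ∣ ∁ S ∣ + + k) (∣⊥∣≡0 n) ⟩
      a - + ∣ ∁ S ∣ + 0ℤ                      ≡⟨ ℤ.+-identityʳ _ ⟩
      a - + ∣ ∁ S ∣                           ∎
      where
      open ≡-Reasoning
      cv≡a = on v v∈S
      poor : ∀ w → Poorer (K n) c v w ⇔ w ∈ ∁ S
      poor w = mk⇔
        (λ (_ , cw<cv) → x∉p⇒x∈∁p λ w∈S → ℤ.<-irrefl (trans (on w w∈S) (sym cv≡a)) cw<cv)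
        (λ w∈∁S → let w∉S = x∈∁p⇒x∉p w∈∁S in
          -- Adjacency in `K n` is distinctness, and vertices on different sides of `S` are
          -- distinct.
          (λ v≡w → w∉S (subst (_∈ S) v≡w v∈S)) , subst₂ _<_ (sym (off w w∉S)) (sym cv≡a) b<a)
      rich : ∀ w → ¬ Richer (K n) c v w
      rich w (_ , cv<cw) with w ∈? S
      ... | yes w∈S = ℤ.<-irrefl (trans cv≡a (sym (on w w∈S))) cv<cw
      ... | no  w∉S = ℤ.<-asym b<a (subst₂ _<_ cv≡a (off w w∉S) cv<cw)
    off-step : ∀ v → v ∉ S → step (K n) c v ≡ b + + ∣ S ∣
    off-step v v∉S = begin
      step (K n) c v                  ≡⟨ step-value {c} ⊥ S cv≡b (empty poor) rich ⟩
      b - + ∣ ⊥ {n} ∣ + + ∣ S ∣        ≡⟨ cong (λ k → b - + k + + ∣ S ∣) (∣⊥∣≡0 n) ⟩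
      b - 0ℤ + + ∣ S ∣                 ≡⟨ cong (_+ + ∣ S ∣) (ℤ.+-identityʳ b) ⟩
      b + + ∣ S ∣                      ∎
      where
      open ≡-Reasoning
      cv≡b = off v v∉S
      poor : ∀ w → ¬ Poorer (K n) c v w
      poor w (_ , cw<cv) with w ∈? S
      ... | yes w∈S = ℤ.<-asym b<a (subst₂ _<_ (on w w∈S) cv≡b cw<cv)
      ... | no  w∉S = ℤ.<-irrefl (trans (off w w∉S) (sym cv≡b)) cw<cv
      rich : ∀ w → Richer (K n) c v w ⇔ w ∈ S
      rich w = mk⇔ to-S
        (λ w∈S → (λ v≡w → v∉S (subst (_∈ S) (sym v≡w) w∈S)) , subst₂ _<_ (sym cv≡b) (sym (on w w∈S)) b<a)
        where
        to-S : Richer (K n) c v w → w ∈ S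
        to-S (_ , cv<cw) with w ∈? S
        ... | yes w∈S = w∈S
        ... | no  w∉S = contradiction cv<cw (ℤ.<-irrefl (trans cv≡b (sym (off w w∉S))))

  -- The mirror image of `Split-step->`, obtained by exchanging `S` with its complement; the only
  -- mismatch is the size of the double complement.
  Split-step-< : ∀ {S a b c} → a < b → Split S a b c →
    Split S (a + + ∣ ∁ S ∣) (b - + ∣ S ∣) (step (K n) c)
  Split-step-< {S} {a} {b} {c} a<b split = Split-∁⁻
    (subst (λ k → Split (∁ S) (b - + k) (a + + ∣ ∁ S ∣) (step (K n) c)) (∣∁∁p∣≡∣p∣ S)
      (Split-step-> a<b (Split-∁ split)))

  Split-step-≡ : ∀ {S a c} → Split S a a c → Split S a a (step (K n) c)
  Split-step-≡ {S} {a} {c} (on , off) = (λ v _ → step≡a v) , (λ v _ → step≡a v)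
    where
    c≡a : ∀ v → c v ≡ a
    c≡a v with v ∈? S
    ... | yes v∈S = on v v∈S
    ... | no  v∉S = off v v∉S
    step≡a : ∀ v → step (K n) c v ≡ a
    step≡a v = begin
      step (K n) c v                          ≡⟨ step-value {c} ⊥ ⊥ (c≡a v)
                                                   (empty λ w (_ , lt) → ℤ.<-irrefl (trans (c≡a w) (sym (c≡a v))) lt)
                                                   (empty λ w (_ , lt) → ℤ.<-irrefl (trans (c≡a v) (sym (c≡a w))) lt) ⟩
      a - + ∣ ⊥ {n} ∣ + + ∣ ⊥ {n} ∣            ≡⟨ cong (λ k → a - + k + + k) (∣⊥∣≡0 n) ⟩
      a - 0ℤ + 0ℤ                             ≡⟨ trans (ℤ.+-identityʳ _) (ℤ.+-identityʳ a) ⟩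
      a                                       ∎
      where open ≡-Reasoning

  i<i+[1+j] : ∀ i j → i < i + + ℕ.suc j
  i<i+[1+j] i j = subst (_< i + + ℕ.suc j) (ℤ.+-identityʳ i) (ℤ.+-monoʳ-< i (+<+ ℕ.z<s))

  Tight-period-2 : ∀ {S a b c} → Split S a b c → Split S a b (step (K n) (step (K n) c)) → Tight (K n) c
  Tight-period-2 split split″ = 0 , Split-unique split″ split

  -- The first step reverses the order of the two values, so the second moves the same amounts back:
  -- `∣ ∁ S ∣` to each vertex of `S` and `∣ S ∣` away from each other vertex.
  Tight-overshoot : ∀ {S a b c} → a > b → a - + ∣ ∁ S ∣ < b + + ∣ S ∣ → Split S a b c → Tight (K n) c
  Tight-overshoot {S} {a} {b} {c} a>b a′<b′ split = Tight-period-2 split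
    (subst₂ (λ x y → Split S x y (step (K n) (step (K n) c)))
      (i-j+j≡i a (+ ∣ ∁ S ∣)) (i+j-j≡i b (+ ∣ S ∣))
      (Split-step-< a′<b′ (Split-step-> a>b split)))
    where
    i-j+j≡i : ∀ i j → i - j + j ≡ i
    i-j+j≡i = solve-∀
    i+j-j≡i : ∀ i j → i + j - j ≡ i
    i+j-j≡i = solve-∀

  -- Writing the gap as a natural number `D` makes it the measure of the descent; the recursion is
  -- well-founded rather than structural because the gap falls by `n` at a time.
  Tight-Split : n ≥ 1 → ∀ {S D b c} → Acc ℕ._<_ D → Split S (b + + D) b c → Tight (K n) c
  Tight-Split n≥1 {S} {ℕ.zero} {b} {c} _ split =
    Tight-period-2 split′ (Split-step-≡ (Split-step-≡ split′))
    where
    split′ : Split S b b c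
    split′ = subst (λ x → Split S x b c) (ℤ.+-identityʳ b) split
  Tight-Split n≥1 {S} {D@(ℕ.suc D-1)} {b} {c} (acc rec) split with ℕ.≤-<-connex n D
  -- The gap after one step is `e`, the difference of `D` and `n`; it is still nonnegative, and
  -- smaller than `D` because `n ≥ 1`.
  ... | inj₁ n≤D with e , n+e≡D ← ℕ.m≤n⇒∃[o]m+o≡n n≤D =
    Tight-step⁻ (K n) c (Tight-Split n≥1 (rec e<D)
      (subst (λ x → Split S x (b + + ∣ S ∣) (step (K n) c)) a′≡b′+e (Split-step-> (i<i+[1+j] b D-1) split)))
    where
    e<D : e ℕ.< D
    e<D = subst (e ℕ.<_) n+e≡D (ℕ.m<n+m e n≥1)
    shift : ∀ b k m e → b + (k + m + e) - m ≡ b + k + e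
    shift = solve-∀
    a′≡b′+e : b + + D - + ∣ ∁ S ∣ ≡ b + + ∣ S ∣ + + e
    -- Decompose `D` as `∣ S ∣` plus `∣ ∁ S ∣` plus `e`: the second part is what a vertex of `S`
    -- loses, the first is what the lower value gains.
    a′≡b′+e = trans
      (cong (λ x → b + + x - + ∣ ∁ S ∣) (trans (sym n+e≡D) (cong (ℕ._+ e) (sym (∣p∣+∣∁p∣≡n S)))))
      (shift b (+ ∣ S ∣) (+ ∣ ∁ S ∣) (+ e))
  -- A positive gap below `n`, the sum of `∣ S ∣` and `∣ ∁ S ∣`, changes sign in one step.
  ... | inj₂ D<n = Tight-overshoot (i<i+[1+j] b D-1) a′<b′ split
    where
    shift : ∀ b k m → b + (k + m) - m ≡ b + k
    shift = solve-∀
    a′<b′ : b + + D - + ∣ ∁ S ∣ < b + + ∣ S ∣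
    a′<b′ = subst (b + + D - + ∣ ∁ S ∣ <_) (shift b (+ ∣ S ∣) (+ ∣ ∁ S ∣))
      (ℤ.+-monoˡ-< (ℤ.- + ∣ ∁ S ∣) (ℤ.+-monoʳ-< b (+<+ (subst (D ℕ.<_) (sym (∣p∣+∣∁p∣≡n S)) D<n))))

  Tight-Split-≥ : n ≥ 1 → ∀ {S a b c} → b ≤ a → Split S a b c → Tight (K n) c
  Tight-Split-≥ n≥1 {S} {a} {b} {c} b≤a split =
    Tight-Split n≥1 (<-wellFounded ℤ.∣ a - b ∣) (subst (λ x → Split S x b c) a≡b+D split)
    where
    i≡j+[i-j] : ∀ i j → i ≡ j + (i - j)
    i≡j+[i-j] = solve-∀
    a≡b+D : a ≡ b + + ℤ.∣ a - b ∣
    a≡b+D = trans (i≡j+[i-j] a b) (cong (λ x → b + x) (sym (ℤ.0≤i⇒+∣i∣≡i (ℤ.i≤j⇒0≤j-i b≤a))))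

theorem17 : (n : ℕ) → n ≥ 1 → (α β d : ℤ) → 1ℤ ≤ d → d ≤ + n →
    (c₀ : Config n) → TwoValued d α β c₀ → Tight (K n) c₀
theorem17 n n≥1 α β d _ _ c₀ (S , _ , on , off) with ℤ.≤-total β α
... | inj₁ β≤α = Tight-Split-≥ n≥1 {S} β≤α (on , off)
-- The larger value now lies on the complement, which takes over the role of `S`.
... | inj₂ α≤β = Tight-Split-≥ n≥1 {∁ S} α≤β (Split-∁ (on , off))
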